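{- There exists an infinite family of Boolean matrices $(A_n)_{n}$, with $A_n$ of size $n\times n$, such that for each $n$, every cancellation-free linear circuit computing $A_n$ has size at least $(2-o(1))$ times the size of a smallest linear circuit (cancellations allowed) computing $A_n$. Consequently the cancellation ratio satisfies $\rho(n)\geq 2-o(1)$.
   Context: A linear circuit over $\mathbb{F}_2$ with inputs $x_1,\ldots,x_n$ is a directed acyclic graph whose in-degree-0 nodes are the inputs and whose other nodes (gates) have in-degree 2 and compute the sum over $\mathbb{F}_2$ (XOR) of their two children; $m$ nodes are designated as outputs $y_1,\ldots,y_m$. The circuit computes the Boolean $m\times n$ matrix $A$ if $\mathbf{y}=A\mathbf{x}$ for all $\mathbf{x}\in\mathbb{F}_2^n$ (output $y_i$ computes the $i$-th row). The size of a circuit is its number of gates. Each node $u$ computes a parity of a subset of inputs; its value vector $\kappa(u)\in\mathbb{F}_2^n$ has $\kappa(u)_i=1$ iff $x_i$ occurs in that parity (so $\kappa(x_i)=e^{(i)}$ and $\kappa(u)=\kappa(w)\oplus\kappa(t)$ for a gate with children $w,t$). A linear circuit is cancellation-free if whenever there is a directed path from a node $w$ to a node $u$, we have $\kappa(u)\geq\kappa(w)$ in the coordinatewise order. The cancellation ratio $\rho(n)$ is the maximum, over $n\times n$ Boolean matrices $A$, of the ratio between the size of a smallest cancellation-free linear circuit computing $A$ and the size of a smallest linear circuit computing $A$. -}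

module Defs where

open import Data.Bool using (Bool; false; _∧_; _xor_; _≤_)
open import Data.Fin using (Fin; zero; suc; _≟_)
open import Data.Integer using (+_)
open import Data.Nat as ℕ using (ℕ; NonZero)
open import Data.Product using (Σ-syntax; ∃-syntax; _×_)
open import Data.Rational as ℚ using (ℚ; 0ℚ; ∣_∣)
open import Data.Vec.Functional using (Vector; foldr; zipWith)
open import Relation.Binary.Construct.Closure.ReflexiveTransitive using (Star)
open import Relation.Binary.PropositionalEquality using (_≡_; _≢_)
open import Relation.Nullary.Decidable using (does)

-- Elements of F₂ are Booleans, with _xor_ as addition and _∧_ as multiplication.

Matrix : ℕ → ℕ → Set
Matrix m n = Vector (Vector Bool n) m

infixl 6 _⊕_
_⊕_ : ∀ {n} → Vector Bool n → Vector Bool n → Vector Bool n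
_⊕_ = zipWith _xor_

_·_ : ∀ {m n} → Matrix m n → Vector Bool n → Vector Bool m
(A · x) i = foldr _xor_ false (zipWith _∧_ (A i) x)

𝐞 : ∀ {n} → Fin n → Vector Bool n
𝐞 i j = does (i ≟ j)

record Gate (k : ℕ) : Set where
  constructor gate
  field
    left right : Fin k
    distinct   : left ≢ right

open Gate public

-- The underlying graph, listed in a topological order.  Its nodes are the
-- elements of Fin (s + n): the most recent gate is zero, older nodes are
-- shifted by suc, and the n inputs come last.  Children of a gate are among
-- the nodes present before it, which is exactly acyclicity.

infixl 5 _▷_
data DAG (n : ℕ) : ℕ → Set where
  inputs : DAG n 0
  _▷_    : ∀ {s} → DAG n s → Gate (s ℕ.+ n) → DAG n (ℕ.suc s)

Node : ∀ {n s} → DAG n s → Set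
Node {n} {s} _ = Fin (s ℕ.+ n)

data Edge {n : ℕ} : ∀ {s} (G : DAG n s) → Node G → Node G → Set where
  fromLeft  : ∀ {s} {G : DAG n s} {g} → Edge (G ▷ g) (suc (left g)) zero
  fromRight : ∀ {s} {G : DAG n s} {g} → Edge (G ▷ g) (suc (right g)) zero
  earlier   : ∀ {s} {G : DAG n s} {g w u} → Edge G w u → Edge (G ▷ g) (suc w) (suc u)

Path : ∀ {n s} (G : DAG n s) → Node G → Node G → Set
Path G = Star (Edge G)

value : ∀ {n s} (G : DAG n s) → Vector Bool n → Node G → Bool
value inputs  x i       = x i
value (G ▷ g) x zero    = value G x (left g) xor value G x (right g)
value (G ▷ g) x (suc u) = value G x u

κ : ∀ {n s} (G : DAG n s) → Node G → Vector Bool n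
κ inputs  i       = 𝐞 i
κ (G ▷ g) zero    = κ G (left g) ⊕ κ G (right g)
κ (G ▷ g) (suc u) = κ G u

-- Outputs are arbitrary nodes: they may be inputs, and may coincide.

record Circuit (n m : ℕ) : Set where
  field
    size   : ℕ
    dag    : DAG n size
    output : Fin m → Node dag

open Circuit public

Computes : ∀ {n m} → Circuit n m → Matrix m n → Set
Computes C A = ∀ x i → value (dag C) x (output C i) ≡ (A · x) i

CancellationFree : ∀ {n m} → Circuit n m → Set
CancellationFree C = ∀ w u → Path (dag C) w u → ∀ i → κ (dag C) w i ≤ κ (dag C) u i

IsSmallest : ∀ {n m} → Matrix m n → Circuit n m → Set
IsSmallest A C = Computes C A × (∀ C′ → Computes C′ A → size C ℕ.≤ size C′)

IsSmallestCancellationFree : ∀ {n m} → Matrix m n → Circuit n m → Set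
IsSmallestCancellationFree A C =
  CancellationFree C × Computes C A ×
  (∀ C′ → CancellationFree C′ → Computes C′ A → size C ℕ.≤ size C′)

-- The ratio is undefined for matrices with a zero row, which have no
-- cancellation-free circuit, and for those computable without gates (0/0).

IsRatioOf : ∀ {n m} → Matrix m n → ℚ → Set
IsRatioOf A q =
  ∃[ C ] ∃[ D ] IsSmallestCancellationFree A C × IsSmallest A D ×
  Σ[ nz ∈ NonZero (size D) ] q ≡ ((+ size C) ℚ./ size D) {{nz}}

-- IsCancellationRatio n r is the graph of ρ: it says ρ(n) = r.  No ratio is
-- defined for n < 2; for n ≥ 2 the maximum is over a nonempty finite set.

IsCancellationRatio : ℕ → ℚ → Set
IsCancellationRatio n r =
  (Σ[ A ∈ Matrix n n ] IsRatioOf A r) ×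
  (∀ (A : Matrix n n) q → IsRatioOf A q → q ℚ.≤ r)

IsLittleO1 : (ℕ → ℚ) → Set
IsLittleO1 ε = ∀ δ → 0ℚ ℚ.< δ → ∃[ N ] (∀ n → N ℕ.≤ n → ∣ ε n ∣ ℚ.< δ)

fromℕ : ℕ → ℚ
fromℕ k = (+ k) ℚ./ 1

{-# OPTIONS --safe #-}
module Submission where

open import Defs
open import Data.Nat as ℕ using (ℕ)
open import Data.Product using (Σ-syntax; ∃-syntax; _×_)
open import Data.Rational using (ℚ; _≤_; _*_; _-_)

open import Algebra.Bundles using (CommutativeRing)
open import Data.Bool as 𝔹 using (Bool; true; false; _∧_; _xor_)
import Data.Bool.Properties as 𝔹ₚ
open import Data.Fin using (Fin; zero; suc; toℕ; fromℕ<; _≟_; _↑ˡ_; splitAt; join; inject₁; inject≤; combine; remQuot)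
open import Data.Fin.Patterns using (0F; 1F; 2F)
import Data.Fin.Properties as Finₚ
open import Data.Integer as ℤ using (ℤ; +_)
import Data.Integer.Properties as ℤₚ
import Data.Integer.Solver as ℤ-Solver
open import Data.Nat using (zero; suc; _+_; z≤n; s≤s)
import Data.Nat.Properties as ℕₚ
import Data.Nat.Solver as ℕ-Solver
open import Data.Product using (∃; _,_; proj₁; proj₂)
open import Data.Rational as ℚ using (mkℚ; 0ℚ; ∣_∣; toℚᵘ)
import Data.Rational.Properties as ℚₚ
open import Data.Rational.Unnormalised as ℚᵘ using (mkℚᵘ)
import Data.Rational.Unnormalised.Properties as ℚᵘₚ
open import Data.Sum using (_⊎_; inj₁; inj₂)
open import Data.Unit using (⊤; tt)
open import Data.Vec.Functional using (Vector; foldr; zipWith)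
open import Function using (_∘_; Injective)
import Relation.Binary.Construct.Closure.ReflexiveTransitive as Star
open import Relation.Binary.PropositionalEquality
  using (_≡_; _≢_; _≗_; refl; sym; trans; cong; cong₂; subst; subst₂)
open import Relation.Nullary using (¬_; Dec; does; yes; no; contradiction)
open import Relation.Nullary.Decidable using (dec-true; dec-false; decidable-stable; _⊎-dec_; _×-dec_)
open import Algebra.Properties.CommutativeSemigroup
  (CommutativeRing.+-commutativeSemigroup 𝔹ₚ.xor-∧-commutativeRing)
  using () renaming (interchange to xor-interchange)

-- A gate of a cancellation-free circuit is a disjoint union of its children.  Hence if no row of a
-- family F is covered by two others (F is 2-cover-free), each node computing a row has a child that
-- lies below no other row; these children and the nodes computing rows are pairwise distinct.  At
-- most D of them are inputs when the rows are supported on D columns, so N rows cost at least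
-- 2N - D gates.
--
-- To make such a family cheap with cancellations, attach to every pair u = (a , b) in [q]² the
-- three marks (0 , a), (1 , b), (2 , a + b); distinct pairs share at most one mark, so three marks
-- cannot be covered by those of two other pairs.  Columns are pairs (y , z) of marks, and the row
-- (u , v) is P u ⊕ Q v, where P u (Q v) consists of the columns whose first (second) component is a
-- mark of u (of v).  With all P u and Q v precomputed in O(q³) gates, each of the N = q⁴ rows
-- costs a single gate, while D = O(q²).

private
  variable
    m n s t k d c : ℕ
    f g : Vector Bool n
    T : Set

-- Parities and value vectors

_∙_ : Vector Bool n → Vector Bool n → Bool
f ∙ x = foldr _xor_ false (zipWith _∧_ f x)

false≢true : false ≢ true
false≢true ()

∙-cong : f ≗ g → ∀ x → f ∙ x ≡ g ∙ x
∙-cong {zero}  f≗g x = refl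
∙-cong {suc n} f≗g x =
  cong₂ _xor_ (cong (_∧ x zero) (f≗g zero)) (∙-cong (f≗g ∘ suc) (x ∘ suc))

∙-distribʳ-⊕ : ∀ (f g x : Vector Bool n) → (f ⊕ g) ∙ x ≡ (f ∙ x) xor (g ∙ x)
∙-distribʳ-⊕ {zero}  f g x = refl
∙-distribʳ-⊕ {suc n} f g x =
  trans (cong₂ _xor_ (𝔹ₚ.∧-distribʳ-xor (x zero) (f zero) (g zero)) (∙-distribʳ-⊕ (f ∘ suc) (g ∘ suc) (x ∘ suc)))
        (xor-interchange (f zero ∧ x zero) (g zero ∧ x zero) _ _)

zero-∙ : (∀ j → f j ≡ false) → ∀ x → f ∙ x ≡ false
zero-∙ {zero}  f≡0 x = refl
zero-∙ {suc n} f≡0 x =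
  cong₂ _xor_ (cong (_∧ x zero) (f≡0 zero)) (zero-∙ (f≡0 ∘ suc) (x ∘ suc))

𝐞-diag : ∀ (i : Fin n) → 𝐞 i i ≡ true
𝐞-diag i = dec-true (i ≟ i) refl

𝐞-true⇒≡ : ∀ (i j : Fin n) → 𝐞 i j ≡ true → i ≡ j
𝐞-true⇒≡ i j eᵢⱼ with i ≟ j
... | yes i≡j = i≡j

𝐞-suc : ∀ (i j : Fin n) → 𝐞 (suc i) (suc j) ≡ 𝐞 i j
𝐞-suc i j with i ≟ j
... | yes _ = refl
... | no  _ = refl

𝐞-∙ : ∀ (i : Fin n) x → 𝐞 i ∙ x ≡ x i
𝐞-∙ zero    x = trans (cong (x zero xor_) (zero-∙ (λ _ → refl) (x ∘ suc))) (𝔹ₚ.xor-identityʳ (x zero))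
𝐞-∙ (suc i) x = trans (∙-cong (𝐞-suc i) (x ∘ suc)) (𝐞-∙ i (x ∘ suc))

∙-comm : ∀ (f x : Vector Bool n) → f ∙ x ≡ x ∙ f
∙-comm {zero}  f x = refl
∙-comm {suc n} f x = cong₂ _xor_ (𝔹ₚ.∧-comm (f zero) (x zero)) (∙-comm (f ∘ suc) (x ∘ suc))

∙-𝐞 : ∀ (f : Vector Bool n) i → f ∙ 𝐞 i ≡ f i
∙-𝐞 f i = trans (∙-comm f (𝐞 i)) (𝐞-∙ i f)

value≡κ∙ : ∀ (G : DAG n s) x u → value G x u ≡ κ G u ∙ x
value≡κ∙ inputs  x u       = sym (𝐞-∙ u x)
value≡κ∙ (G ▷ g) x zero    =
  trans (cong₂ _xor_ (value≡κ∙ G x (left g)) (value≡κ∙ G x (right g)))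
        (sym (∙-distribʳ-⊕ (κ G (left g)) (κ G (right g)) x))
value≡κ∙ (G ▷ g) x (suc u) = value≡κ∙ G x u

-- Evaluating at the unit vectors reads off the value vector of an output coordinate by coordinate.
computes⇒κ : ∀ (C : Circuit n m) A → Computes C A → ∀ i → κ (dag C) (output C i) ≗ A i
computes⇒κ C A C-A i j =
  trans (sym (∙-𝐞 (κ (dag C) (output C i)) j))
        (trans (sym (value≡κ∙ (dag C) (𝐞 j) (output C i)))
               (trans (C-A (𝐞 j) i) (∙-𝐞 (A i) j)))

κ⇒computes : ∀ (C : Circuit n m) A → (∀ i → κ (dag C) (output C i) ≗ A i) → Computes C A
κ⇒computes C A κ≗A x i =
  trans (value≡κ∙ (dag C) x (output C i)) (∙-cong (κ≗A i) x)

-- Inputs have unit value vectors, so a node with two ones is a gate and has children.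
HasTwo : Vector Bool n → Set
HasTwo f = ∃[ x ] ∃[ y ] x ≢ y × f x ≡ true × f y ≡ true

edge-decreases : ∀ {G : DAG n s} {w u} → Edge G w u → toℕ u ℕ.< toℕ w
edge-decreases fromLeft    = s≤s z≤n
edge-decreases fromRight   = s≤s z≤n
edge-decreases (earlier e) = s≤s (edge-decreases e)

𝐞-¬HasTwo : ∀ (i : Fin n) → ¬ HasTwo (𝐞 i)
𝐞-¬HasTwo i (x , y , x≢y , eˣ , eʸ) = x≢y (trans (sym (𝐞-true⇒≡ i x eˣ)) (𝐞-true⇒≡ i y eʸ))

HasTwo⇒size>0 : ∀ (C : Circuit n m) A → Computes C A → ∀ i → HasTwo (A i) → 0 ℕ.< size C
HasTwo⇒size>0 C A C-A i (x , y , x≢y , Ax , Ay) =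
  go (dag C) (output C i) (x , y , x≢y , trans (computes⇒κ C A C-A i x) Ax , trans (computes⇒κ C A C-A i y) Ay)
  where
  go : ∀ {s} (G : DAG n s) u → HasTwo (κ G u) → 0 ℕ.< s
  go inputs  u two = contradiction two (𝐞-¬HasTwo u)
  go (G ▷ g) u two = s≤s z≤n

children : ∀ (G : DAG n s) u → HasTwo (κ G u) →
  ∃[ w ] ∃[ t ] Edge G w u × Edge G t u × κ G u ≗ κ G w ⊕ κ G t
children inputs  u       two = contradiction two (𝐞-¬HasTwo u)
children (G ▷ g) zero    two = suc (left g) , suc (right g) , fromLeft , fromRight , λ _ → refl
children (G ▷ g) (suc u) two with children G u two
... | w , t , w→u , t→u , κu = suc w , suc t , earlier w→u , earlier t→u , κu

-- The gates take the first `s` indices, and an input has its only one in its own column. So only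
-- the first `d` inputs can be among such nodes.
supported⇒toℕ< : ∀ (G : DAG n s) u → (∀ x → κ G u x ≡ true → toℕ x ℕ.< d) → toℕ u ℕ.< s + d
supported⇒toℕ< inputs  u       supp = supp u (𝐞-diag u)
supported⇒toℕ< (G ▷ g) zero    supp = s≤s z≤n
supported⇒toℕ< (G ▷ g) (suc u) supp = s≤s (supported⇒toℕ< G u supp)

-- Lower bound for cancellation-free circuits

-- Taking j ≡ k shows that such a family is an antichain.
CoverFree : (Fin m → Vector Bool n) → Set
CoverFree F = ∀ i j k → j ≢ i → k ≢ i →
  ∃[ x ] F i x ≡ true × F j x ≡ false × F k x ≡ false

-- Both alternatives are decidable for each `j`, so a failure yields an explicit other row above
-- `Z`.
Separated : (Fin m → Vector Bool n) → Fin m → Vector Bool n → Set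
Separated F i Z = ∀ j → j ≡ i ⊎ ∃[ x ] Z x ≡ true × F j x ≡ false

separated? : ∀ (F : Fin m → Vector Bool n) i Z →
  Separated F i Z ⊎ ∃[ j ] j ≢ i × (∀ x → Z x ≡ true → F j x ≡ true)
separated? F i Z = from (Finₚ.all? sep?)
  where
  sep? : ∀ j → Dec (j ≡ i ⊎ ∃[ x ] Z x ≡ true × F j x ≡ false)
  sep? j = (j ≟ i) ⊎-dec Finₚ.any? (λ x → (Z x 𝔹ₚ.≟ true) ×-dec (F j x 𝔹ₚ.≟ false))
  from : Dec (Separated F i Z) → Separated F i Z ⊎ ∃[ j ] j ≢ i × (∀ x → Z x ≡ true → F j x ≡ true)
  from (yes sep) = inj₁ sep
  from (no ¬sep) with Finₚ.¬∀⟶∃¬ _ _ sep? ¬sep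
  ... | j , ¬sepⱼ = inj₂ (j , ¬sepⱼ ∘ inj₁ , λ x Zx → 𝔹ₚ.¬-not (λ Fjx → ¬sepⱼ (inj₂ (x , Zx , Fjx))))

module _ (G : DAG n s) (cf : ∀ w u → Path G w u → ∀ i → κ G w i 𝔹.≤ κ G u i)
         (F : Fin m → Vector Bool n) (coverFree : CoverFree F) (two : ∀ i → HasTwo (F i))
         (supp : ∀ i x → F i x ≡ true → toℕ x ℕ.< d)
         (out : Fin m → Node G) (κ-out : ∀ i → κ G (out i) ≗ F i) where

  SeparatedChild : Fin m → Node G → Set
  SeparatedChild i w = Edge G w (out i) × Separated F i (κ G w)

  child-⊆ : ∀ i w → Edge G w (out i) → ∀ x → κ G w x ≡ true → F i x ≡ true
  child-⊆ i w e x κx = trans (sym (κ-out i x)) (up (cf w (out i) (e Star.◅ Star.ε) x) κx)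
    where
    up : ∀ {a b} → a 𝔹.≤ b → a ≡ true → b ≡ true
    up 𝔹.b≤b eq = eq

  -- If both children lay below other rows, cover-freeness would give a one of `F i` outside these
  -- rows. Both children vanish there, and so does their sum.
  separatedChild : ∀ i → ∃ (SeparatedChild i)
  separatedChild i with children G (out i) (two′ (two i))
    where
    two′ : HasTwo (F i) → HasTwo (κ G (out i))
    two′ (x , y , x≢y , Fx , Fy) = x , y , x≢y , trans (κ-out i x) Fx , trans (κ-out i y) Fy
  ... | w , t , w→u , t→u , κu with separated? F i (κ G w) | separated? F i (κ G t)
  ... | inj₁ sep | _        = w , w→u , sep
  ... | inj₂ _   | inj₁ sep = t , t→u , sep
  ... | inj₂ (j , j≢i , w⊆Fj) | inj₂ (k , k≢i , t⊆Fk) with coverFree i j k j≢i k≢i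
  ... | x , Fix , Fjx , Fkx = contradiction (trans (sym xor≡false) (trans (sym (κu x)) (trans (κ-out i x) Fix))) false≢true
    where
    outside : ∀ {Z : Vector Bool n} {l} → (∀ x → Z x ≡ true → F l x ≡ true) → F l x ≡ false → Z x ≡ false
    outside Z⊆ Flx = 𝔹ₚ.¬-not (λ Zx → false≢true (trans (sym Flx) (Z⊆ x Zx)))
    xor≡false : κ G w x xor κ G t x ≡ false
    xor≡false = cong₂ _xor_ (outside w⊆Fj Fjx) (outside t⊆Fk Fkx)

  child : Fin m → Node G
  child i = proj₁ (separatedChild i)

  separated-⊆⇒≡ : ∀ i j Z → Separated F i Z → (∀ x → Z x ≡ true → F j x ≡ true) → j ≡ i
  separated-⊆⇒≡ i j Z sep Z⊆Fj with sep j
  ... | inj₁ j≡i            = j≡i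
  ... | inj₂ (x , Zx , Fjx) = contradiction (trans (sym Fjx) (Z⊆Fj x Zx)) false≢true

  -- Cancellation-freeness puts a child of `out j` below `F j`, while a child separated for `i` lies
  -- below no row other than `F i`.
  child-injective : ∀ i j → child i ≡ child j → j ≡ i
  child-injective i j eq with separatedChild i | separatedChild j
  child-injective i j refl | w , _ , sep | .w , e , _ =
    separated-⊆⇒≡ i j (κ G w) sep (child-⊆ j w e)

  out-⊆⇒≡ : ∀ i j → (∀ x → F i x ≡ true → F j x ≡ true) → j ≡ i
  out-⊆⇒≡ i j Fi⊆Fj with j ≟ i
  ... | yes j≡i = j≡i
  ... | no  j≢i with coverFree i j j j≢i j≢i
  ... | x , Fix , Fjx , _ = contradiction (trans (sym Fjx) (Fi⊆Fj x Fix)) false≢true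

  out-injective : ∀ i j → out i ≡ out j → j ≡ i
  out-injective i j eq =
    out-⊆⇒≡ i j (λ x Fix → trans (sym (κ-out j x)) (trans (cong (λ u → κ G u x) (sym eq)) (trans (κ-out i x) Fix)))

  -- An equality would put `F i` below `F j` and so force `i` and `j` to coincide. The node would
  -- then be its own child, against the topological numbering.
  out≢child : ∀ i j → out i ≢ child j
  out≢child i j eq with separatedChild j
  ... | w , e , _ = ℕₚ.<-irrefl (cong toℕ (trans (cong out i≡j′) eq)) (edge-decreases e)
    where
    i≡j′ : j ≡ i
    i≡j′ = out-⊆⇒≡ i j (λ x Fix → child-⊆ j w e x (trans (cong (λ u → κ G u x) (sym eq)) (trans (κ-out i x) Fix)))

  node : Fin m ⊎ Fin m → Node G
  node (inj₁ i) = out i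
  node (inj₂ i) = child i

  node-injective : ∀ a b → node a ≡ node b → a ≡ b
  node-injective (inj₁ i) (inj₁ j) eq = cong inj₁ (sym (out-injective i j eq))
  node-injective (inj₁ i) (inj₂ j) eq = contradiction eq (out≢child i j)
  node-injective (inj₂ i) (inj₁ j) eq = contradiction (sym eq) (out≢child j i)
  node-injective (inj₂ i) (inj₂ j) eq = cong inj₂ (sym (child-injective i j eq))

  node-bound : ∀ a → toℕ (node a) ℕ.< s + d
  node-bound (inj₁ i) = supported⇒toℕ< G (out i) (λ x κx → supp i x (trans (sym (κ-out i x)) κx))
  node-bound (inj₂ i) with separatedChild i
  ... | w , e , _ = supported⇒toℕ< G w (λ x κx → supp i x (child-⊆ i w e x κx))

  -- The outputs and their separated children are 2m distinct nodes, all among the first `s + d`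
  -- indices.
  cancellationFree-lowerBound : m + m ℕ.≤ s + d
  cancellationFree-lowerBound = Finₚ.injective⇒≤ {f = λ a → fromℕ< (node-bound (splitAt m a))} inj
    where
    inj : Injective _≡_ _≡_ (λ a → fromℕ< (node-bound (splitAt m a)))
    inj {a} {b} eq = trans (sym (Finₚ.join-splitAt m m a)) (trans (cong (join m m) ab) (Finₚ.join-splitAt m m b))
      where
      ab : splitAt m a ≡ splitAt m b
      ab = node-injective (splitAt m a) (splitAt m b)
             (Finₚ.toℕ-injective (Finₚ.fromℕ<-injective _ _ (node-bound (splitAt m a)) (node-bound (splitAt m b)) eq))

-- Extending circuits

-- A gatewise condition sufficient for cancellation-freeness: a sum of disjoint supports is their
-- union. When a circuit grows, it has to be checked at the new gate only.
Disjoint : DAG n s → Set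
Disjoint inputs  = ⊤
Disjoint (G ▷ g) = (∀ x → κ G (left g) x ∧ κ G (right g) x ≡ false) × Disjoint G

disjoint⇒≤ˡ : ∀ a b → a ∧ b ≡ false → a 𝔹.≤ a xor b
disjoint⇒≤ˡ false false _ = 𝔹.b≤b
disjoint⇒≤ˡ false true  _ = 𝔹.f≤t
disjoint⇒≤ˡ true  false _ = 𝔹.b≤b

disjoint⇒≤ʳ : ∀ a b → a ∧ b ≡ false → b 𝔹.≤ a xor b
disjoint⇒≤ʳ false b     _ = 𝔹.b≤b
disjoint⇒≤ʳ true  false _ = 𝔹.f≤t

edge-monotone : ∀ (G : DAG n s) → Disjoint G → ∀ {w u} → Edge G w u → ∀ x → κ G w x 𝔹.≤ κ G u x
edge-monotone (G ▷ g) (dg , dG) fromLeft    x = disjoint⇒≤ˡ _ (κ G (right g) x) (dg x)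
edge-monotone (G ▷ g) (dg , dG) fromRight   x = disjoint⇒≤ʳ (κ G (left g) x) _ (dg x)
edge-monotone (G ▷ g) (dg , dG) (earlier e) x = edge-monotone G dG e x

path-monotone : ∀ (G : DAG n s) → Disjoint G → ∀ w u → Path G w u → ∀ x → κ G w x 𝔹.≤ κ G u x
path-monotone G dG w u Star.ε     x = 𝔹.b≤b
path-monotone G dG w u (e Star.◅ p) x = 𝔹ₚ.≤-trans (edge-monotone G dG e x) (path-monotone G dG _ u p x)

Available : DAG n s → Vector Bool n → Set
Available G f = ∃[ u ] κ G u ≗ f

available-resp : ∀ (G : DAG n s) → f ≗ g → Available G f → Available G g
available-resp G f≗g (u , κu) = u , λ x → trans (κu x) (f≗g x)

𝐞-available : ∀ (G : DAG n s) i → Available G (𝐞 i)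
𝐞-available inputs  i = i , λ _ → refl
𝐞-available (G ▷ g) i with 𝐞-available G i
... | u , κu = suc u , κu

infix 4 _≼_
-- Graphs are compared by the vectors they compute, since node indices shift with every added gate.
_≼_ : DAG n s → DAG n t → Set
_≼_ {n} G H = ∀ (f : Vector Bool n) → Available G f → Available H f

≼-step : ∀ (G : DAG n s) g → G ≼ G ▷ g
≼-step G g f (u , κu) = suc u , κu

-- `I` is threaded through successive extensions: it is `Disjoint` while no cancellation may occur,
-- and `G₀ ≼_` where only the vectors of a base graph must be kept.
record Extension {n s} (G : DAG n s) (I : ∀ {t} → DAG n t → Set) (k : ℕ) {J : Set}
                 (F : J → Vector Bool n) : Set where
  constructor extension
  field
    {size′}   : ℕ
    dag′      : DAG n size′
    bound     : size′ ℕ.≤ k + s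
    invariant : I dag′
    extends   : G ≼ dag′
    available : ∀ j → Available dag′ (F j)

Extension₁ : DAG n s → (∀ {t} → DAG n t → Set) → ℕ → Vector Bool n → Set
Extension₁ G I k f = Extension G I k {Fin 1} (λ _ → f)

extension-resp : ∀ {G : DAG n s} {I : ∀ {t} → DAG n t → Set} {F F′ : T → Vector Bool n} →
                 (∀ j → F j ≗ F′ j) → Extension G I k F → Extension G I k F′
extension-resp F≗F′ (extension G′ b i G≼G′ a) = extension G′ b i G≼G′ (λ j → available-resp G′ (F≗F′ j) (a j))

extendAll : ∀ {I : ∀ {t} → DAG n t → Set} (F : Fin k → Vector Bool n) →
            (∀ {t} (G : DAG n t) → I G → ∀ i → Extension₁ G I c (F i)) →
            ∀ (G : DAG n s) → I G → Extension G I (k ℕ.* c) F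
extendAll {k = zero} F one G iG = extension G ℕₚ.≤-refl iG (λ _ a → a) λ ()
extendAll {n} {k = suc k} {c} {s = s} {I} F one G iG
  with extendAll {I = I} (F ∘ suc) (λ H iH i → one H iH (suc i)) G iG
... | extension G₁ b₁ i₁ G≼G₁ a₁ with one G₁ i₁ zero
... | extension G₂ b₂ i₂ G₁≼G₂ a₂ =
  extension G₂ bound i₂ (λ f → G₁≼G₂ f ∘ G≼G₁ f) λ { zero → a₂ zero ; (suc j) → G₁≼G₂ _ (a₁ j) }
  where
  bound = ℕₚ.≤-trans b₂ (ℕₚ.≤-trans (ℕₚ.+-monoʳ-≤ c b₁) (ℕₚ.≤-reflexive (sym (ℕₚ.+-assoc c (k ℕ.* c) s))))

-- A gate needs distinct children, which holds as soon as the sum is nonzero.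
join-available : ∀ (G₀ : DAG n t) (G : DAG n s) → G₀ ≼ G → Available G f → Available G g →
                 ∃[ x ] (f ⊕ g) x ≡ true → Extension₁ G (G₀ ≼_) 1 (f ⊕ g)
join-available G₀ G G₀≼G (w , κw) (t , κt) (x , fgx) =
  extension (G ▷ gate w t w≢t) ℕₚ.≤-refl (λ h → ≼-step G _ h ∘ G₀≼G h) (≼-step G _)
            λ _ → zero , λ x → cong₂ _xor_ (κw x) (κt x)
  where
  w≢t : w ≢ t
  w≢t refl = false≢true (trans (sym (𝔹ₚ.xor-same (κ G w x))) (trans (cong₂ _xor_ (κw x) (κt x)) fgx))

module _ (f : Vector Bool n) where

  -- Truncations serve to assemble `f` one input at a time: the next unit vector is disjoint from
  -- what has been summed so far.
  below : ℕ → Vector Bool n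
  below m x = f x ∧ (toℕ x ℕ.<ᵇ m)

  below-suc : ∀ m (m<n : m ℕ.< n) x → below (suc m) x ≡ below m x xor (f (fromℕ< m<n) ∧ 𝐞 (fromℕ< m<n) x)
  below-suc m m<n x with fromℕ< m<n ≟ x
  ... | yes refl with f (fromℕ< m<n)
  ...   | false = refl
  ...   | true rewrite Finₚ.toℕ-fromℕ< m<n = trans (<ᵇ-true (ℕₚ.n<1+n m)) (sym (cong (_xor true) (<ᵇ-false m)))
    where
    <ᵇ-true : ∀ {a b} → a ℕ.< b → (a ℕ.<ᵇ b) ≡ true
    <ᵇ-true {a} {b} a<b = dec-true (a ℕₚ.<? b) a<b
    <ᵇ-false : ∀ a → (a ℕ.<ᵇ a) ≡ false
    <ᵇ-false a = dec-false (a ℕₚ.<? a) (ℕₚ.<-irrefl refl)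
  below-suc m m<n x | no ≢x with f x
  ... | false = sym (𝔹ₚ.∧-zeroʳ (f (fromℕ< m<n)))
  ... | true = trans lem (sym (trans (cong ((toℕ x ℕ.<ᵇ m) xor_) (𝔹ₚ.∧-zeroʳ (f (fromℕ< m<n)))) (𝔹ₚ.xor-identityʳ _)))
    where
    lem : (toℕ x ℕ.<ᵇ suc m) ≡ (toℕ x ℕ.<ᵇ m)
    lem with toℕ x ℕₚ.<? m
    ... | yes x<m = trans (dec-true (toℕ x ℕₚ.<? suc m) (ℕₚ.m<n⇒m<1+n x<m)) (sym (dec-true (toℕ x ℕₚ.<? m) x<m))
    ... | no  x≮m = trans (dec-false (toℕ x ℕₚ.<? suc m) x≮1+m) (sym (dec-false (toℕ x ℕₚ.<? m) x≮m))
      where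
      x≮1+m : ¬ toℕ x ℕ.< suc m
      x≮1+m (s≤s x≤m) = ≢x (Finₚ.toℕ-injective (trans (Finₚ.toℕ-fromℕ< m<n) (ℕₚ.≤-antisym (ℕₚ.≮⇒≥ x≮m) x≤m)))

  below-self : ∀ m (m<n : m ℕ.< n) → below m (fromℕ< m<n) ≡ false
  below-self m m<n rewrite Finₚ.toℕ-fromℕ< m<n | dec-false (m ℕₚ.<? m) (ℕₚ.<-irrefl refl) = 𝔹ₚ.∧-zeroʳ _

  below≗f : ∀ m → (∀ x → f x ≡ true → toℕ x ℕ.< m) → below m ≗ f
  below≗f m supp x with f x in fx
  ... | false = refl
  ... | true  = dec-true (toℕ x ℕₚ.<? m) (supp x fx)

  -- No node of a disjoint circuit has value vector zero, so a truncation that is still zero forms a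
  -- case of its own.
  extendByBelow : ∀ (G : DAG n s) → Disjoint G → ∀ m → m ℕ.≤ n →
    (∀ x → below m x ≡ false) ⊎ Extension₁ G Disjoint m (below m)
  extendByBelow G dG zero    _   = inj₁ (λ x → 𝔹ₚ.∧-zeroʳ (f x))
  extendByBelow {s = s} G dG (suc m) m<n = go (f y) refl (extendByBelow G dG m (ℕₚ.<⇒≤ m<n))
    where
    y = fromℕ< m<n
    step : ∀ {b} → f y ≡ b → ∀ x → below (suc m) x ≡ below m x xor (b ∧ 𝐞 y x)
    step refl = below-suc m m<n
    skip : f y ≡ false → ∀ x → below (suc m) x ≡ below m x
    skip fy x = trans (step fy x) (𝔹ₚ.xor-identityʳ _)
    go : ∀ b → f y ≡ b → (∀ x → below m x ≡ false) ⊎ Extension₁ G Disjoint m (below m) →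
         (∀ x → below (suc m) x ≡ false) ⊎ Extension₁ G Disjoint (suc m) (below (suc m))
    go false fy (inj₁ zero≗) = inj₁ λ x → trans (skip fy x) (zero≗ x)
    go false fy (inj₂ (extension G′ b i e a)) =
      inj₂ (extension G′ (ℕₚ.m≤n⇒m≤1+n b) i e λ j → available-resp G′ (sym ∘ skip fy) (a j))
    -- The first one of `f` costs no gate: the truncation is then a unit vector.
    go true fy (inj₁ zero≗) = inj₂ (extension G (ℕₚ.m≤n+m s (suc m)) dG (λ _ a → a) λ _ →
      available-resp G (λ x → sym (trans (step fy x) (cong (_xor 𝐞 y x) (zero≗ x)))) (𝐞-available G y))
    go true fy (inj₂ (extension G₁ b₁ i₁ e₁ a₁)) =
      inj₂ (extension (G₁ ▷ gate w v w≢v) (s≤s b₁) (disj , i₁) (λ h → ≼-step G₁ _ h ∘ e₁ h)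
        λ _ → zero , λ x → trans (cong₂ _xor_ (κw x) (κv x)) (sym (step fy x)))
      where
      w = proj₁ (a₁ zero)
      κw = proj₂ (a₁ zero)
      v = proj₁ (𝐞-available G₁ y)
      κv = proj₂ (𝐞-available G₁ y)
      -- The truncation is still zero in column `y`, where the unit vector has its one. The same
      -- fact makes the new gate disjoint.
      w≢v : w ≢ v
      w≢v w≡v = false≢true (trans (sym (trans (κw y) (below-self m m<n)))
                                  (trans (cong (λ u → κ G₁ u y) w≡v) (trans (κv y) (𝐞-diag y))))
      disj : ∀ x → κ G₁ w x ∧ κ G₁ v x ≡ false
      disj x rewrite κw x | κv x with y ≟ x
      ... | no  _    = 𝔹ₚ.∧-zeroʳ _
      ... | yes refl = trans (𝔹ₚ.∧-identityʳ _) (below-self m m<n)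

  -- The cost is the bound `m` on the support rather than `n`, so padded vectors stay cheap in wide
  -- matrices.
  extendDisjointly : ∀ (G : DAG n s) → Disjoint G → ∀ m → m ℕ.≤ n → (∀ x → f x ≡ true → toℕ x ℕ.< m) →
    ∃[ x ] f x ≡ true → Extension₁ G Disjoint m f
  extendDisjointly G dG m m≤n supp (x , fx) with extendByBelow G dG m m≤n
  ... | inj₁ zero≗ = contradiction (trans (sym (zero≗ x)) (trans (below≗f m supp x) fx)) false≢true
  ... | inj₂ E     = extension-resp (λ _ → below≗f m supp) E

availableCircuit : ∀ (G : DAG n s) (A : Matrix m n) → (∀ i → Available G (A i)) → Circuit n m
availableCircuit {s = s} G A a = record { size = s ; dag = G ; output = λ i → proj₁ (a i) }

availableCircuit-computes : ∀ (G : DAG n s) (A : Matrix m n) a → Computes (availableCircuit G A a) A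
availableCircuit-computes G A a = κ⇒computes (availableCircuit G A a) A (λ i → proj₂ (a i))

cancellationFreeCircuit : ∀ (A : Matrix m n) → (∀ i → ∃[ x ] A i x ≡ true) →
  ∃[ C ] CancellationFree C × Computes C A
cancellationFreeCircuit {n = n} A nonzero with extendAll {I = Disjoint} A each inputs tt
  where
  each : ∀ {t} (G : DAG n t) → Disjoint G → ∀ i → Extension₁ G Disjoint n (A i)
  each G dG i = extendDisjointly (A i) G dG n ℕₚ.≤-refl (λ x _ → Finₚ.toℕ<n x) (nonzero i)
... | extension G b dG _ a =
  availableCircuit G A a , path-monotone G dG , availableCircuit-computes G A a

-- Smallest circuits

Smallest : (Circuit n m → Set) → Circuit n m → Set
Smallest P C = P C × (∀ C′ → P C′ → size C ℕ.≤ size C′)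

-- Infinite descent: if no circuit is smallest, induction on a size bound `b` refutes `P` for all
-- circuits of size below `b`. As `P` need not be decidable, the conclusion is doubly negated.
¬¬smallest : ∀ {P : Circuit n m → Set} → ∃ P → ¬ ¬ ∃ (Smallest P)
¬¬smallest {P = P} (C₀ , P₀) none = go (suc (size C₀)) C₀ (ℕₚ.n<1+n _) P₀
  where
  go : ∀ b C → size C ℕ.< b → ¬ P C
  go (suc b) C (s≤s C≤b) PC = none (C , PC , least)
    where
    least : ∀ C′ → P C′ → size C ℕ.≤ size C′
    least C′ PC′ with size C ℕₚ.≤? size C′
    ... | yes C≤C′ = C≤C′
    ... | no  C≰C′ = contradiction PC′ (go b C′ (ℕₚ.<-≤-trans (ℕₚ.≰⇒> C≰C′) C≤b))

-- A cover-free family of rows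

padAt : ∀ {x} → Vector Bool d → Dec (x ℕ.< d) → Bool
padAt f (yes p) = f (fromℕ< p)
padAt f (no  _) = false

pad : ∀ n → Vector Bool d → Vector Bool n
pad {d} n f x = padAt f (toℕ x ℕₚ.<? d)

pad-supported : ∀ (f : Vector Bool d) (x : Fin n) → pad n f x ≡ true → toℕ x ℕ.< d
pad-supported {d} f x fx with toℕ x ℕₚ.<? d
... | yes x<d = x<d

pad-⊕ : ∀ (f g : Vector Bool d) → pad n f ⊕ pad n g ≗ pad n (f ⊕ g)
pad-⊕ {d} f g x with toℕ x ℕₚ.<? d
... | yes _ = refl
... | no  _ = refl

pad-inject≤ : ∀ (f : Vector Bool d) j (d≤n : d ℕ.≤ n) → pad n f (inject≤ j d≤n) ≡ f j
pad-inject≤ {d} f j d≤n with toℕ (inject≤ j d≤n) ℕₚ.<? d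
... | yes p = cong f (Finₚ.toℕ-injective (trans (Finₚ.toℕ-fromℕ< p) (Finₚ.toℕ-inject≤ j d≤n)))
... | no ¬p = contradiction (subst (ℕ._< d) (sym (Finₚ.toℕ-inject≤ j d≤n)) (Finₚ.toℕ<n j)) ¬p

module Family (q : ℕ) where

  Pair : Set
  Pair = Fin (q ℕ.* q)

  -- `S` counts the possible marks: three tags for the coordinates and one for `null`, each with a
  -- value below 2q so that the sums a + b fit.
  S D N : ℕ
  S = 4 ℕ.* (q + q)
  D = S ℕ.* S
  N = (q ℕ.* q) ℕ.* (q ℕ.* q)

  -- From the inside out, in order of construction: the default row, the strips along `π₁` and `π₂`,
  -- then the halves along `π₁` and `π₂` at two gates per pair. The sum is O(q³).
  overhead : ℕ
  overhead = q ℕ.* q ℕ.* 2 + (q ℕ.* q ℕ.* 2 + (S ℕ.* D + (S ℕ.* D + (2 + 0))))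

  fst snd : Pair → Fin q
  fst u = proj₁ (remQuot q u)
  snd u = proj₂ (remQuot {q} q u)

  pair-≡ : ∀ {u v} → fst u ≡ fst v → snd u ≡ snd v → u ≡ v
  pair-≡ {u} {v} a b =
    trans (sym (Finₚ.combine-remQuot {q} q u)) (trans (cong₂ combine a b) (Finₚ.combine-remQuot {q} q v))

  coord : Fin 3 → Pair → Fin (q + q)
  coord 0F u = fst u ↑ˡ q
  coord 1F u = snd u ↑ˡ q
  coord 2F u = fromℕ< (ℕₚ.+-mono-< (Finₚ.toℕ<n (fst u)) (Finₚ.toℕ<n (snd u)))

  toℕ-coord₂ : ∀ u → toℕ (coord 2F u) ≡ toℕ (fst u) + toℕ (snd u)
  toℕ-coord₂ u = Finₚ.toℕ-fromℕ< _

  coord₂-≡ : ∀ {u v} → coord 2F u ≡ coord 2F v →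
             toℕ (fst u) + toℕ (snd u) ≡ toℕ (fst v) + toℕ (snd v)
  coord₂-≡ {u} {v} eq = trans (sym (toℕ-coord₂ u)) (trans (cong toℕ eq) (toℕ-coord₂ v))

  agree₀₁ : ∀ {u v} → coord 0F u ≡ coord 0F v → coord 1F u ≡ coord 1F v → u ≡ v
  agree₀₁ a b = pair-≡ (Finₚ.↑ˡ-injective q _ _ a) (Finₚ.↑ˡ-injective q _ _ b)

  agree₀₂ : ∀ {u v} → coord 0F u ≡ coord 0F v → coord 2F u ≡ coord 2F v → u ≡ v
  agree₀₂ {u} {v} a c = pair-≡ a′ (Finₚ.toℕ-injective (ℕₚ.+-cancelˡ-≡ (toℕ (fst v)) _ _
    (trans (cong (λ z → toℕ z + toℕ (snd u)) (sym a′)) (coord₂-≡ {u} {v} c))))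
    where a′ = Finₚ.↑ˡ-injective q _ _ a

  agree₁₂ : ∀ {u v} → coord 1F u ≡ coord 1F v → coord 2F u ≡ coord 2F v → u ≡ v
  agree₁₂ {u} {v} b c = pair-≡ (Finₚ.toℕ-injective (ℕₚ.+-cancelʳ-≡ (toℕ (snd v)) _ _
    (trans (cong (λ z → toℕ (fst u) + toℕ z) (sym b′)) (coord₂-≡ {u} {v} c)))) b′
    where b′ = Finₚ.↑ˡ-injective q _ _ b

  -- Any two of a, b, a + b determine the pair, so `v` and `w` each rule out at most one of the
  -- three coordinates.
  isolate : ∀ u v w → v ≢ u → w ≢ u → ∃[ r ] coord r v ≢ coord r u × coord r w ≢ coord r u
  isolate u v w v≢u w≢u
    with coord 0F v ≟ coord 0F u | coord 1F v ≟ coord 1F u | coord 2F v ≟ coord 2F u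
       | coord 0F w ≟ coord 0F u | coord 1F w ≟ coord 1F u | coord 2F w ≟ coord 2F u
  ... | no v₀ | _     | _     | no w₀ | _     | _     = 0F , v₀ , w₀
  ... | _     | no v₁ | _     | _     | no w₁ | _     = 1F , v₁ , w₁
  ... | _     | _     | no v₂ | _     | _     | no w₂ = 2F , v₂ , w₂
  ... | yes a | yes b | _     | _     | _     | _     = contradiction (agree₀₁ a b) v≢u
  ... | yes a | _     | yes c | _     | _     | _     = contradiction (agree₀₂ a c) v≢u
  ... | _     | yes b | yes c | _     | _     | _     = contradiction (agree₁₂ b c) v≢u
  ... | _     | _     | _     | yes a | yes b | _     = contradiction (agree₀₁ a b) w≢u
  ... | _     | _     | _     | yes a | _     | yes c = contradiction (agree₀₂ a c) w≢u
  ... | _     | _     | _     | _     | yes b | yes c = contradiction (agree₁₂ b c) w≢u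

  mark : Fin 3 → Pair → Fin S
  mark r u = combine (inject₁ r) (coord r u)

  -- Tag 3 marks no pair: a column with such a component is seen by only one half of a row.
  null : Pair → Fin S
  null u = combine (Data.Fin.fromℕ 3) (coord 0F u)

  -- The three marks have different tags, so at most one summand is true and the sum acts as a
  -- union. Written as a sum, it splits into strips.
  hits : Pair → Fin S → Bool
  hits u z = does (mark 0F u ≟ z) xor (does (mark 1F u ≟ z) xor does (mark 2F u ≟ z))

  tag-≢ : ∀ {r p u v} → r ≢ p → mark r u ≢ mark p v
  tag-≢ {r} {p} {u} {v} r≢p =
    r≢p ∘ Finₚ.inject₁-injective ∘ Finₚ.combine-injectiveˡ (inject₁ r) (coord r u) (inject₁ p) (coord p v)

  marks-differ : ∀ r p u v → r ≢ p → does (mark r u ≟ mark p v) ≡ false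
  marks-differ r p u v r≢p = dec-false (mark r u ≟ mark p v) (tag-≢ {r} {p} {u} {v} r≢p)

  null-differs : ∀ r u v → does (mark r u ≟ null v) ≡ false
  null-differs r u v = dec-false (mark r u ≟ null v)
    (Finₚ.fromℕ≢inject₁ ∘ sym ∘ Finₚ.combine-injectiveˡ (inject₁ r) (coord r u) (Data.Fin.fromℕ 3) (coord 0F v))

  mark-≡ : ∀ r u v → coord r u ≡ coord r v → does (mark r u ≟ mark r v) ≡ true
  mark-≡ r u v eq = dec-true (mark r u ≟ mark r v) (cong (combine (inject₁ r)) eq)

  mark-≢ : ∀ r u v → coord r u ≢ coord r v → does (mark r u ≟ mark r v) ≡ false
  mark-≢ r u v neq = dec-false (mark r u ≟ mark r v) (neq ∘ Finₚ.combine-injectiveʳ (inject₁ r) (coord r u) (inject₁ r) (coord r v))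

  hits-mark : ∀ r u v → hits u (mark r v) ≡ does (mark r u ≟ mark r v)
  hits-mark 0F u v =
    trans (cong₂ (λ x y → does (mark 0F u ≟ mark 0F v) xor (x xor y))
                 (marks-differ 1F 0F u v λ ()) (marks-differ 2F 0F u v λ ()))
          (𝔹ₚ.xor-identityʳ _)
  hits-mark 1F u v =
    trans (cong₂ (λ x y → x xor (does (mark 1F u ≟ mark 1F v) xor y))
                 (marks-differ 0F 1F u v λ ()) (marks-differ 2F 1F u v λ ()))
          (𝔹ₚ.xor-identityʳ _)
  hits-mark 2F u v =
    cong₂ (λ x y → x xor (y xor does (mark 2F u ≟ mark 2F v)))
          (marks-differ 0F 2F u v λ ()) (marks-differ 1F 2F u v λ ())

  hits-≡ : ∀ r u v → coord r u ≡ coord r v → hits u (mark r v) ≡ true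
  hits-≡ r u v eq = trans (hits-mark r u v) (mark-≡ r u v eq)

  hits-≢ : ∀ r u v → coord r u ≢ coord r v → hits u (mark r v) ≡ false
  hits-≢ r u v neq = trans (hits-mark r u v) (mark-≢ r u v neq)

  hits-null : ∀ u v → hits u (null v) ≡ false
  hits-null u v =
    cong₂ _xor_ (null-differs 0F u v) (cong₂ _xor_ (null-differs 1F u v) (null-differs 2F u v))

  π₁ π₂ : Fin D → Fin S
  π₁ x = proj₁ (remQuot {S} S x)
  π₂ x = proj₂ (remQuot {S} S x)

  π₁-combine : ∀ y z → π₁ (combine y z) ≡ y
  π₁-combine y z = cong proj₁ (Finₚ.remQuot-combine {S} {S} y z)

  π₂-combine : ∀ y z → π₂ (combine y z) ≡ z
  π₂-combine y z = cong proj₂ (Finₚ.remQuot-combine {S} {S} y z)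

  -- P u is `half π₁ u`, and Q v is `half π₂ v`.
  half : (Fin D → Fin S) → Pair → Vector Bool D
  half π u x = hits u (π x)

  ind₁ ind₂ : Fin N → Pair
  ind₁ i = proj₁ (remQuot (q ℕ.* q) i)
  ind₂ i = proj₂ (remQuot {q ℕ.* q} (q ℕ.* q) i)

  ind-≡ : ∀ {i j} → ind₁ i ≡ ind₁ j → ind₂ i ≡ ind₂ j → i ≡ j
  ind-≡ {i} {j} a b =
    trans (sym (Finₚ.combine-remQuot {q ℕ.* q} (q ℕ.* q) i)) (trans (cong₂ combine a b) (Finₚ.combine-remQuot {q ℕ.* q} (q ℕ.* q) j))

  F : Fin N → Vector Bool D
  F i = half π₁ (ind₁ i) ⊕ half π₂ (ind₂ i)

  F-combine : ∀ i y z → F i (combine y z) ≡ hits (ind₁ i) y xor hits (ind₂ i) z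
  F-combine i y z = cong₂ _xor_ (cong (hits (ind₁ i)) (π₁-combine y z)) (cong (hits (ind₂ i)) (π₂-combine y z))

  F-at : ∀ i y z {a b} → hits (ind₁ i) y ≡ a → hits (ind₂ i) z ≡ b → F i (combine y z) ≡ a xor b
  F-at i y z refl refl = F-combine i y z

  -- Either `j` and `k` both differ from `i` in the same index, or one shares only the first index
  -- with `i` and the other only the second.
  F-coverFree : CoverFree F
  F-coverFree i j k j≢i k≢i
    with ind₁ j ≟ ind₁ i | ind₁ k ≟ ind₁ i | ind₂ j ≟ ind₂ i | ind₂ k ≟ ind₂ i
  -- The null second component silences the second halves, so a mark of `ind₁ i` missed by both
  -- other pairs suffices.
  ... | no j₁ | no k₁ | _ | _ with isolate (ind₁ i) (ind₁ j) (ind₁ k) j₁ k₁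
  ...   | r , jr , kr = combine y z , F-at i y z (hits-≡ r (ind₁ i) u refl) (hits-null (ind₂ i) u)
                      , F-at j y z (hits-≢ r (ind₁ j) u jr) (hits-null (ind₂ j) u)
                      , F-at k y z (hits-≢ r (ind₁ k) u kr) (hits-null (ind₂ k) u)
    where
    u = ind₁ i
    y = mark r u
    z = null u
  F-coverFree i j k j≢i k≢i | _ | _ | no j₂ | no k₂ with isolate (ind₂ i) (ind₂ j) (ind₂ k) j₂ k₂
  ...   | r , jr , kr = combine y z , F-at i y z (hits-null (ind₁ i) v) (hits-≡ r (ind₂ i) v refl)
                      , F-at j y z (hits-null (ind₁ j) v) (hits-≢ r (ind₂ j) v jr)
                      , F-at k y z (hits-null (ind₁ k) v) (hits-≢ r (ind₂ k) v kr)
    where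
    v = ind₂ i
    y = null v
    z = mark r v
  -- Take a mark of `ind₁ i` missed by `ind₁ k`, and a mark of `ind₂ j` missed by `ind₂ i`. Row `i`
  -- is 1 + 0 there, row `j` cancels as 1 + 1, and row `k` is 0 + 0.
  F-coverFree i j k j≢i k≢i | yes j₁ | no k₁ | no j₂ | yes k₂
    with isolate (ind₁ i) (ind₁ k) (ind₁ k) k₁ k₁ | isolate (ind₂ j) (ind₂ i) (ind₂ i) (j₂ ∘ sym) (j₂ ∘ sym)
  ...   | r , kr , _ | p , ip , _ = combine y z
                      , F-at i y z (hits-≡ r (ind₁ i) (ind₁ i) refl) (hits-≢ p (ind₂ i) (ind₂ j) ip)
                      , F-at j y z (hits-≡ r (ind₁ j) (ind₁ i) (cong (coord r) j₁)) (hits-≡ p (ind₂ j) (ind₂ j) refl)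
                      , F-at k y z (hits-≢ r (ind₁ k) (ind₁ i) kr) (hits-≢ p (ind₂ k) (ind₂ j) (ip ∘ trans (cong (coord p) (sym k₂))))
    where
    y = mark r (ind₁ i)
    z = mark p (ind₂ j)
  -- The same choice with `j` and `k` exchanged.
  F-coverFree i j k j≢i k≢i | no j₁ | yes k₁ | yes j₂ | no k₂
    with isolate (ind₁ i) (ind₁ j) (ind₁ j) j₁ j₁ | isolate (ind₂ k) (ind₂ i) (ind₂ i) (k₂ ∘ sym) (k₂ ∘ sym)
  ...   | r , jr , _ | p , ip , _ = combine y z
                      , F-at i y z (hits-≡ r (ind₁ i) (ind₁ i) refl) (hits-≢ p (ind₂ i) (ind₂ k) ip)
                      , F-at j y z (hits-≢ r (ind₁ j) (ind₁ i) jr) (hits-≢ p (ind₂ j) (ind₂ k) (ip ∘ trans (cong (coord p) (sym j₂))))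
                      , F-at k y z (hits-≡ r (ind₁ k) (ind₁ i) (cong (coord r) k₁)) (hits-≡ p (ind₂ k) (ind₂ k) refl)
    where
    y = mark r (ind₁ i)
    z = mark p (ind₂ k)
  F-coverFree i j k j≢i k≢i | yes j₁ | _ | yes j₂ | _ = contradiction (ind-≡ j₁ j₂) j≢i
  F-coverFree i j k j≢i k≢i | _ | yes k₁ | _ | yes k₂ = contradiction (ind-≡ k₁ k₂) k≢i

  F-two : ∀ i → HasTwo (F i)
  F-two i = combine (mark 0F u) z , combine (mark 1F u) z , x≢y
          , F-at i (mark 0F u) z (hits-≡ 0F u u refl) (hits-null (ind₂ i) u)
          , F-at i (mark 1F u) z (hits-≡ 1F u u refl) (hits-null (ind₂ i) u)
    where
    u = ind₁ i
    z = null u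
    x≢y : combine (mark 0F u) z ≢ combine (mark 1F u) z
    x≢y eq = tag-≢ {0F} {1F} {u} {u} (λ ())
      (Finₚ.combine-injectiveˡ (mark 0F u) z (mark 1F u) z eq)

  -- The matrices and their circuits

  rowAt : ∀ {i} → Dec (i ℕ.< N) → Vector Bool n
  rowAt {n} (yes p) = pad n (F (fromℕ< p))
  -- All remaining rows are one default row, so together they cost at most two gates. Its two ones
  -- (for n at least 2) still force a gate.
  rowAt     (no  _) = λ x → toℕ x ℕ.<ᵇ 2

  A : ∀ n → Matrix n n
  A n i = rowAt (toℕ i ℕₚ.<? N)

  module _ (D≤n : D ℕ.≤ n) where

    at : Fin D → Fin n
    at x = inject≤ x D≤n

    pad-two : ∀ i → HasTwo (pad n (F i))
    pad-two i with F-two i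
    ... | x , y , x≢y , Fx , Fy = at x , at y , x≢y ∘ Finₚ.inject≤-injective D≤n D≤n x y
                                , trans (pad-inject≤ (F i) x D≤n) Fx , trans (pad-inject≤ (F i) y D≤n) Fy

    pad-coverFree : CoverFree (λ i → pad n (F i))
    pad-coverFree i j k j≢i k≢i with F-coverFree i j k j≢i k≢i
    ... | x , Fi , Fj , Fk = at x , trans (pad-inject≤ (F i) x D≤n) Fi
                           , trans (pad-inject≤ (F j) x D≤n) Fj , trans (pad-inject≤ (F k) x D≤n) Fk

    module _ (N≤n : N ℕ.≤ n) where

      A-inject≤ : ∀ i → A n (inject≤ i N≤n) ≗ pad n (F i)
      A-inject≤ i x with toℕ (inject≤ i N≤n) ℕₚ.<? N
      ... | yes p = cong (λ l → pad n (F l) x) (Finₚ.toℕ-injective (trans (Finₚ.toℕ-fromℕ< p) (Finₚ.toℕ-inject≤ i N≤n)))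
      ... | no ¬p = contradiction (subst (ℕ._< N) (sym (Finₚ.toℕ-inject≤ i N≤n)) (Finₚ.toℕ<n i)) ¬p

      lowerBound : ∀ C → CancellationFree C → Computes C (A n) → N + N ℕ.≤ size C + D
      lowerBound C cf C-A = cancellationFree-lowerBound (dag C) cf (λ i → pad n (F i)) pad-coverFree pad-two
        (λ i → pad-supported (F i)) (λ i → output C (inject≤ i N≤n))
        (λ i x → trans (computes⇒κ C (A n) C-A (inject≤ i N≤n) x) (A-inject≤ i x))

    -- Each half is a sum of three strips. Building the q² halves directly, at up to `D` gates each,
    -- would only give a bound of order q⁴, like the number of rows; sharing the `S` strips brings
    -- it down to O(q³).
    strip : (Fin D → Fin S) → Fin S → Vector Bool D
    strip π z x = does (z ≟ π x)

    -- A diagonal column has component `z` under both projections, so `π-diag` serves `π₁` and `π₂`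
    -- alike and exhibits a one in each strip.
    strips : ∀ (π : Fin D → Fin S) → (∀ z → π (combine z z) ≡ z) → ∀ (G : DAG n s) → Disjoint G →
             Extension G Disjoint (S ℕ.* D) (λ z → pad n (strip π z))
    strips π π-diag = extendAll {I = Disjoint} (λ z → pad n (strip π z)) λ G dG z →
      extendDisjointly (pad n (strip π z)) G dG D D≤n (pad-supported (strip π z))
        (at (combine z z) , trans (pad-inject≤ (strip π z) (combine z z) D≤n) (dec-true (z ≟ _) (sym (π-diag z))))

    halves : ∀ (π : Fin D → Fin S) → (∀ z → π (combine z z) ≡ z) → ∀ (G : DAG n s) →
             (∀ z → Available G (pad n (strip π z))) →
             Extension G (G ≼_) ((q ℕ.* q) ℕ.* 2) (λ u → pad n (half π u))
    halves π π-diag G₀ strip-av = extendAll {I = G₀ ≼_} (λ u → pad n (half π u)) each G₀ (λ _ a → a)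
      where
      each : ∀ {t} (G : DAG n t) → G₀ ≼ G → ∀ u → Extension₁ G (G₀ ≼_) 2 (pad n (half π u))
      -- Marks 1 and 2 are joined first, then mark 0. Each sum has a one in the diagonal column of
      -- one of its marks.
      each G G₀≼G u = go (join-available G₀ G G₀≼G (av 1F) (av 2F) (at (diag 1F) ,
                            trans (pad-⊕ (st 1F) (st 2F) (at (diag 1F)))
                              (trans (pad-inject≤ (st 1F ⊕ st 2F) (diag 1F) D≤n)
                                 (nonzero₁₂ (π-diag (mark 1F u))))))
        where
        st : Fin 3 → Vector Bool D
        st r = strip π (mark r u)
        diag : Fin 3 → Fin D
        diag r = combine (mark r u) (mark r u)
        av : ∀ r → Available G (pad n (st r))
        av r = G₀≼G _ (strip-av (mark r u))
        nonzero₁₂ : ∀ {x} → π x ≡ mark 1F u → (st 1F ⊕ st 2F) x ≡ true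
        nonzero₁₂ eq rewrite eq = cong₂ _xor_ (mark-≡ 1F u u refl) (marks-differ 2F 1F u u λ ())
        nonzero : ∀ {x} → π x ≡ mark 0F u → half π u x ≡ true
        nonzero eq rewrite eq = hits-≡ 0F u u refl
        sum≗ : pad n (st 0F) ⊕ (pad n (st 1F) ⊕ pad n (st 2F)) ≗ pad n (half π u)
        sum≗ x = trans (cong (pad n (st 0F) x xor_) (pad-⊕ (st 1F) (st 2F) x))
                       (pad-⊕ (st 0F) (st 1F ⊕ st 2F) x)
        go : Extension₁ G (G₀ ≼_) 1 (pad n (st 1F) ⊕ pad n (st 2F)) →
             Extension₁ G (G₀ ≼_) 2 (pad n (half π u))
        go (extension G₁ b₁ i₁ e₁ a₁)
          with join-available G₀ G₁ i₁ (e₁ _ (av 0F)) (a₁ zero) (at (diag 0F) ,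
                 trans (sum≗ (at (diag 0F))) (trans (pad-inject≤ (half π u) (diag 0F) D≤n) (nonzero (π-diag (mark 0F u)))))
        ... | extension G₂ b₂ i₂ e₂ a₂ =
          extension G₂ (ℕₚ.≤-trans b₂ (s≤s b₁)) i₂ (λ f → e₂ f ∘ e₁ f) λ j → available-resp G₂ sum≗ (a₂ j)

    -- Only the last stage has order q⁴: once all halves are available, each row of the family takes
    -- one gate, in which cancellation may occur.
    upperBound : 2 ℕ.≤ n → ∃[ C ] Computes C (A n) × size C ℕ.≤ N ℕ.* 1 + overhead
    upperBound 2≤n
      with extendDisjointly (λ x → toℕ x ℕ.<ᵇ 2) inputs tt 2 2≤n (λ x → ℕₚ.<ᵇ⇒< (toℕ x) 2 ∘ λ eq → subst 𝔹.T (sym eq) tt)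
             (inject≤ {2} zero 2≤n , cong (ℕ._<ᵇ 2) (Finₚ.toℕ-inject≤ {2} zero 2≤n))
    ... | extension G₀ b₀ d₀ _ a₀ with strips π₁ (λ z → π₁-combine z z) G₀ d₀
    ... | extension G₁ b₁ d₁ e₁ a₁ with strips π₂ (λ z → π₂-combine z z) G₁ d₁
    ... | extension G₂ b₂ d₂ e₂ a₂ with halves π₁ (λ z → π₁-combine z z) G₂ (λ z → e₂ _ (a₁ z))
    ... | extension G₃ b₃ _ e₃ a₃ with halves π₂ (λ z → π₂-combine z z) G₃ (λ z → e₃ _ (a₂ z))
    ... | extension G₄ b₄ _ e₄ a₄ with extendAll {I = G₄ ≼_} (λ i → pad n (F i)) each G₄ (λ _ a → a)
      where
      each : ∀ {t} (G : DAG n t) → G₄ ≼ G → ∀ i → Extension₁ G (G₄ ≼_) 1 (pad n (F i))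
      each G G₄≼G i = extension-resp (λ _ → ⊕≗)
          (join-available G₄ G G₄≼G (G₄≼G _ (e₄ _ (a₃ (ind₁ i)))) (G₄≼G _ (a₄ (ind₂ i))) (nz (pad-two i)))
        where
        ⊕≗ = pad-⊕ {n = n} (half π₁ (ind₁ i)) (half π₂ (ind₂ i))
        nz : HasTwo (pad n (F i)) → ∃[ x ] (pad n (half π₁ (ind₁ i)) ⊕ pad n (half π₂ (ind₂ i))) x ≡ true
        nz (x , _ , _ , Fx , _) = x , trans (⊕≗ x) Fx
    ... | extension {size₅} G₅ b₅ _ e₅ a₅ =
      availableCircuit G₅ (A n) av , availableCircuit-computes G₅ (A n) av , bound
      where
      av : ∀ i → Available G₅ (A n i)
      av i with toℕ i ℕₚ.<? N
      ... | yes p = a₅ (fromℕ< p)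
      ... | no  _ = e₅ _ (e₄ _ (e₃ _ (e₂ _ (e₁ _ (a₀ zero)))))
      bound : size₅ ℕ.≤ N ℕ.* 1 + overhead
      bound = ℕₚ.≤-trans b₅ (ℕₚ.+-monoʳ-≤ (N ℕ.* 1) (ℕₚ.≤-trans b₄ (ℕₚ.+-monoʳ-≤ (q ℕ.* q ℕ.* 2)
               (ℕₚ.≤-trans b₃ (ℕₚ.+-monoʳ-≤ (q ℕ.* q ℕ.* 2) (ℕₚ.≤-trans b₂ (ℕₚ.+-monoʳ-≤ (S ℕ.* D)
               (ℕₚ.≤-trans b₁ (ℕₚ.+-monoʳ-≤ (S ℕ.* D) b₀)))))))))

  A-nonzero : (N ≢ 0 → D ℕ.≤ n) → ∀ i → ∃[ x ] A n i x ≡ true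
  A-nonzero {suc n} fits i with toℕ i ℕₚ.<? N
  ... | no  _ = zero , refl
  ... | yes p with pad-two (fits λ N≡0 → ℕₚ.n≮0 (subst (toℕ i ℕ.<_) N≡0 p)) (fromℕ< p)
  ...   | x , _ , _ , Fx , _ = x , Fx

  A-two : (N ≢ 0 → D ℕ.≤ n) → 2 ℕ.≤ n → ∀ i → HasTwo (A n i)
  A-two fits (s≤s (s≤s z≤n)) i with toℕ i ℕₚ.<? N
  ... | no  _ = zero , suc zero , (λ ()) , refl , refl
  ... | yes p = pad-two (fits λ N≡0 → ℕₚ.n≮0 (subst (toℕ i ℕ.<_) N≡0 p)) (fromℕ< p)

-- From gate counts to ratios

module _ (c Q C D : ℕ) (bound : 2 ℕ.* suc Q ℕ.* D ℕ.≤ suc Q ℕ.* C + c ℕ.* D) where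

  2-c/Qᵘ : ℚᵘ.ℚᵘ
  2-c/Qᵘ = mkℚᵘ (+ 2) 0 ℚᵘ.- mkℚᵘ (+ c) Q

  toℚᵘ-2-c/Q : toℚᵘ (fromℕ 2 - (+ c) ℚ./ suc Q) ℚᵘ.≃ 2-c/Qᵘ
  toℚᵘ-2-c/Q = ℚᵘₚ.≃-trans (ℚₚ.toℚᵘ-homo-+ (fromℕ 2) (ℚ.- ((+ c) ℚ./ suc Q)))
    (ℚᵘₚ.+-cong (ℚₚ.toℚᵘ-fromℚᵘ (mkℚᵘ (+ 2) 0))
      (ℚᵘₚ.≃-trans (ℚₚ.toℚᵘ-homo‿- ((+ c) ℚ./ suc Q)) (ℚᵘₚ.-‿cong (ℚₚ.toℚᵘ-fromℚᵘ (mkℚᵘ (+ c) Q)))))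

  -- Moving `c` times `D` across `bound` needs subtraction, hence integers. The result is the
  -- cross-multiplied form of both comparisons of fractions that follow.
  numerators : (+ 2 ℤ.* + suc Q ℤ.+ ℤ.- (+ c) ℤ.* + 1) ℤ.* + D ℤ.≤ + C ℤ.* + suc Q
  numerators = begin
    (+ 2 ℤ.* + suc Q ℤ.+ ℤ.- (+ c) ℤ.* + 1) ℤ.* + D
      ≡⟨ solve 3 (λ x y z → (con (+ 2) :* x :+ (:- y) :* con (+ 1)) :* z := (con (+ 2) :* x :* z) :+ (:- (y :* z))) refl (+ suc Q) (+ c) (+ D) ⟩
    (+ 2 ℤ.* + suc Q ℤ.* + D) ℤ.+ ℤ.- (+ c ℤ.* + D)
      ≤⟨ ℤₚ.+-monoˡ-≤ (ℤ.- (+ c ℤ.* + D)) bound′ ⟩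
    (+ suc Q ℤ.* + C ℤ.+ + c ℤ.* + D) ℤ.+ ℤ.- (+ c ℤ.* + D)
      ≡⟨ solve 3 (λ x y z → (x :* y :+ z) :+ (:- z) := y :* x) refl (+ suc Q) (+ C) (+ c ℤ.* + D) ⟩
    + C ℤ.* + suc Q ∎
    where
    open ℤ-Solver.+-*-Solver
    open ℤₚ.≤-Reasoning
    bound′ : + 2 ℤ.* + suc Q ℤ.* + D ℤ.≤ + suc Q ℤ.* + C ℤ.+ + c ℤ.* + D
    bound′ = subst₂ ℤ._≤_
      (trans (ℤₚ.pos-* (2 ℕ.* suc Q) D) (cong (ℤ._* + D) (ℤₚ.pos-* 2 (suc Q))))
      (trans (ℤₚ.pos-+ (suc Q ℕ.* C) (c ℕ.* D)) (cong₂ ℤ._+_ (ℤₚ.pos-* (suc Q) C) (ℤₚ.pos-* c D)))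
      (ℤ.+≤+ bound)

  [2-c/Q]D≤C : (fromℕ 2 - (+ c) ℚ./ suc Q) * fromℕ D ≤ fromℕ C
  [2-c/Q]D≤C = ℚₚ.toℚᵘ-cancel-≤ (begin
    toℚᵘ ((fromℕ 2 - (+ c) ℚ./ suc Q) * fromℕ D)
      ≃⟨ ℚₚ.toℚᵘ-homo-* (fromℕ 2 - (+ c) ℚ./ suc Q) (fromℕ D) ⟩
    toℚᵘ (fromℕ 2 - (+ c) ℚ./ suc Q) ℚᵘ.* toℚᵘ (fromℕ D)
      ≃⟨ ℚᵘₚ.*-cong toℚᵘ-2-c/Q (ℚₚ.toℚᵘ-fromℚᵘ (mkℚᵘ (+ D) 0)) ⟩
    2-c/Qᵘ ℚᵘ.* mkℚᵘ (+ D) 0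
      ≤⟨ ℚᵘ.*≤* (subst₂ ℤ._≤_ (sym (ℤₚ.*-identityʳ _))
           (cong (+ C ℤ.*_) (cong +_ (sym (trans (ℕₚ.*-identityʳ _) (ℕₚ.*-identityˡ (suc Q)))))) numerators) ⟩
    mkℚᵘ (+ C) 0
      ≃⟨ ℚₚ.toℚᵘ-fromℚᵘ (mkℚᵘ (+ C) 0) ⟨
    toℚᵘ (fromℕ C) ∎)
    where open ℚᵘₚ.≤-Reasoning

  2-c/Q≤C/D : (nz : ℕ.NonZero D) → fromℕ 2 - (+ c) ℚ./ suc Q ≤ ((+ C) ℚ./ D) {{nz}}
  2-c/Q≤C/D nz = go D {{nz}} refl
    where
    open ℚᵘₚ.≤-Reasoning
    -- A fresh denominator allows matching on its successor form, where the fraction unfolds.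
    go : ∀ E {{_ : ℕ.NonZero E}} → E ≡ D → fromℕ 2 - (+ c) ℚ./ suc Q ≤ (+ C) ℚ./ E
    go (suc E) refl = ℚₚ.toℚᵘ-cancel-≤ (begin
      toℚᵘ (fromℕ 2 - (+ c) ℚ./ suc Q) ≃⟨ toℚᵘ-2-c/Q ⟩
      2-c/Qᵘ ≤⟨ ℚᵘ.*≤* (subst (_ ℤ.≤_) (cong (+ C ℤ.*_) (cong +_ (sym (ℕₚ.*-identityˡ (suc Q))))) numerators) ⟩
      mkℚᵘ (+ C) E ≃⟨ ℚₚ.toℚᵘ-fromℚᵘ (mkℚᵘ (+ C) E) ⟨
      toℚᵘ ((+ C) ℚ./ suc E) ∎)

-- A positive δ is at least 1/(b + 1) for its denominator b + 1, and c (b + 1) < Q + 1 by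
-- assumption.
c/Q<δ : ∀ c Q δ → 0ℚ ℚ.< δ → c ℕ.* suc (ℚ.denominator-1 δ) ℕ.≤ Q → ∣ (+ c) ℚ./ suc Q ∣ ℚ.< δ
c/Q<δ c Q δ@(mkℚ (+ suc a) b _) 0<δ cb≤Q = subst (ℚ._< δ) (sym abs)
  (ℚₚ.toℚᵘ-cancel-< (ℚᵘₚ.<-respˡ-≃ (ℚᵘₚ.≃-sym (ℚₚ.toℚᵘ-fromℚᵘ (mkℚᵘ (+ c) Q)))
    (ℚᵘ.*<* (subst₂ ℤ._<_ (ℤₚ.pos-* c (suc b)) (ℤₚ.pos-* (suc a) (suc Q))
      (ℤ.+<+ (ℕₚ.≤-trans (s≤s cb≤Q) (ℕₚ.m≤n*m (suc Q) (suc a))))))))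
  where
  abs : ∣ (+ c) ℚ./ suc Q ∣ ≡ (+ c) ℚ./ suc Q
  abs = ℚₚ.0≤p⇒∣p∣≡p (ℚₚ.nonNegative⁻¹ _ {{ℚₚ.normalize-nonNeg c (suc Q)}})
c/Q<δ c Q (mkℚ (+ 0) b _) (ℚ.*<* (ℤ.+<+ ()))
c/Q<δ c Q (mkℚ ℤ.-[1+ _ ] b _) (ℚ.*<* ())

module _ (N K d C D Q c : ℕ) (lower : N + N ℕ.≤ C + d) (upper : D ℕ.≤ N + K)
         (slack : 2 ℕ.* Q ℕ.* K + Q ℕ.* d ℕ.≤ c ℕ.* N) where

  open ℕₚ.≤-Reasoning
  open ℕ-Solver.+-*-Solver

  -- For c ≥ 2Q the last summand suffices. Otherwise put e = 2Q - c; then e D ≤ e (N + K), and 2Q (N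
  -- + K) exceeds Q C by at most 2Q K + Q d, which `slack` absorbs into c N.
  sizes-compare : 2 ℕ.* Q ℕ.* D ℕ.≤ Q ℕ.* C + c ℕ.* D
  sizes-compare with ℕₚ.≤-total (2 ℕ.* Q) c
  ... | inj₁ 2Q≤c = ℕₚ.≤-trans (ℕₚ.*-monoˡ-≤ D 2Q≤c) (ℕₚ.m≤n+m (c ℕ.* D) (Q ℕ.* C))
  ... | inj₂ c≤2Q = begin
    2 ℕ.* Q ℕ.* D     ≡⟨ cong (ℕ._* D) 2Q≡e+c ⟩
    (e + c) ℕ.* D     ≡⟨ ℕₚ.*-distribʳ-+ D e c ⟩
    e ℕ.* D + c ℕ.* D ≤⟨ ℕₚ.+-monoˡ-≤ (c ℕ.* D) (ℕₚ.≤-trans (ℕₚ.*-monoʳ-≤ e upper) eN+eK≤QC) ⟩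
    Q ℕ.* C + c ℕ.* D ∎
    where
    e : ℕ
    e = 2 ℕ.* Q ℕ.∸ c
    2Q≡e+c : 2 ℕ.* Q ≡ e + c
    2Q≡e+c = sym (ℕₚ.m∸n+n≡m c≤2Q)
    eN+eK≤QC : e ℕ.* (N + K) ℕ.≤ Q ℕ.* C
    eN+eK≤QC = ℕₚ.+-cancelʳ-≤ (c ℕ.* (N + K)) _ _ (begin
      e ℕ.* (N + K) + c ℕ.* (N + K) ≡⟨ ℕₚ.*-distribʳ-+ (N + K) e c ⟨
      (e + c) ℕ.* (N + K)           ≡⟨ cong (ℕ._* (N + K)) 2Q≡e+c ⟨
      2 ℕ.* Q ℕ.* (N + K)           ≡⟨ solve 3 (λ Q N K → con 2 :* Q :* (N :+ K) := Q :* (N :+ N) :+ con 2 :* Q :* K) refl Q N K ⟩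
      Q ℕ.* (N + N) + 2 ℕ.* Q ℕ.* K ≤⟨ ℕₚ.+-monoˡ-≤ _ (ℕₚ.*-monoʳ-≤ Q lower) ⟩
      Q ℕ.* (C + d) + 2 ℕ.* Q ℕ.* K ≡⟨ solve 4 (λ Q C d K → Q :* (C :+ d) :+ con 2 :* Q :* K := Q :* C :+ (con 2 :* Q :* K :+ Q :* d)) refl Q C d K ⟩
      Q ℕ.* C + (2 ℕ.* Q ℕ.* K + Q ℕ.* d) ≤⟨ ℕₚ.+-monoʳ-≤ (Q ℕ.* C) slack ⟩
      Q ℕ.* C + c ℕ.* N             ≤⟨ ℕₚ.+-monoʳ-≤ (Q ℕ.* C) (ℕₚ.*-monoʳ-≤ c (ℕₚ.m≤m+n N K)) ⟩
      Q ℕ.* C + c ℕ.* (N + K) ∎)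

-- The hypothesis `slack` with Q = q + 1. Both sides have order q⁴, so one constant `c` can serve
-- all positive q.
Slack : ℕ → ℕ → Set
Slack c q = 2 ℕ.* suc q ℕ.* overhead + suc q ℕ.* D ℕ.≤ c ℕ.* N
  where open Family q

-- At q = 1 the left-hand side of Slack is 4248, and its quotient by N = q⁴ decreases in q.
slack-bound : ∀ p → Slack 4248 (suc p)
slack-bound p = ℕₚ.≤-trans (ℕₚ.m≤m+n _ (rest p)) (ℕₚ.≤-reflexive (expand p))
  where
  open ℕ-Solver.+-*-Solver
  -- The difference of the two sides as a polynomial in p = q - 1: all its coefficients are
  -- nonnegative, and its constant term vanishes.
  rest : ℕ → ℕ
  rest p = 2200 ℕ.* (p ℕ.* (p ℕ.* (p ℕ.* p))) + (6680 ℕ.* (p ℕ.* (p ℕ.* p)) + (6768 ℕ.* (p ℕ.* p) + 2292 ℕ.* p))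
  expand : ∀ p → let q = suc p in let open Family q in
    2 ℕ.* suc q ℕ.* overhead + suc q ℕ.* D + rest p ≡ 4248 ℕ.* N
  expand = solve 1 (λ p → let q = con 1 :+ p ; S = con 4 :* (q :+ q) ; D = S :* S in
    con 2 :* (con 1 :+ q) :* (q :* q :* con 2 :+ (q :* q :* con 2 :+ (S :* D :+ (S :* D :+ (con 2 :+ con 0))))) :+ (con 1 :+ q) :* D
      :+ (con 2200 :* (p :* (p :* (p :* p))) :+ (con 6680 :* (p :* (p :* p)) :+ (con 6768 :* (p :* p) :+ con 2292 :* p)))
      := con 4248 :* ((q :* q) :* (q :* q))) refl

-- The parameter q as a function of n

module Threshold (r : ℕ → ℕ) (r₀ : r 0 ≡ 0) where

  next : ∀ q n → Dec (r (suc q) ℕ.≤ n) → ℕ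
  next q n (yes _) = suc q
  next q n (no  _) = q

  -- A stepwise inverse of `r`; for `room` it grows like the fourth root of n/64.
  param : ℕ → ℕ
  param zero    = 0
  param (suc n) = next (param n) (suc n) (r (suc (param n)) ℕₚ.≤? suc n)

  param-fits : ∀ n → r (param n) ℕ.≤ n
  param-fits zero    = ℕₚ.≤-reflexive r₀
  param-fits (suc n) with r (suc (param n)) ℕₚ.≤? suc n
  ... | yes fits = fits
  ... | no  _    = ℕₚ.m≤n⇒m≤1+n (param-fits n)

  param-suc : ∀ n → param n ℕ.≤ param (suc n)
  param-suc n with r (suc (param n)) ℕₚ.≤? suc n
  ... | yes _ = ℕₚ.n≤1+n _
  ... | no  _ = ℕₚ.≤-refl

  param-grows : ∀ n → r (suc (param n)) ℕ.≤ suc n → param (suc n) ≡ suc (param n)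
  param-grows n fits with r (suc (param n)) ℕₚ.≤? suc n
  ... | yes _    = refl
  ... | no ¬fits = contradiction fits ¬fits

  -- Once the parameter has reached `M` and n also exceeds `r (suc M)`, it is either above `M`
  -- already or raised in the next step.
  param-unbounded : ∀ M → ∃[ L ] (∀ n → L ℕ.≤ n → M ℕ.≤ param n)
  param-unbounded zero = 0 , λ _ _ → z≤n
  param-unbounded (suc M) with param-unbounded M
  ... | L , M≤ = suc (L + r (suc M)) , larger
    where
    larger : ∀ n → suc (L + r (suc M)) ℕ.≤ n → suc M ℕ.≤ param n
    larger (suc n) (s≤s L+r≤n) with ℕₚ.m≤n⇒m<n∨m≡n (M≤ n (ℕₚ.m+n≤o⇒m≤o L L+r≤n))
    ... | inj₁ M<p  = ℕₚ.≤-trans M<p (param-suc n)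
    ... | inj₂ refl = ℕₚ.≤-reflexive (sym (param-grows n (ℕₚ.m≤n⇒m≤1+n (ℕₚ.m+n≤o⇒n≤o L L+r≤n))))

-- The factor 64 is chosen so that both the N rows and the D = 64 q² columns of the family fit.
room : ℕ → ℕ
room q = 64 ℕ.* Family.N q

open Threshold room refl

D≡64q² : ∀ q → 64 ℕ.* (q ℕ.* q) ≡ Family.D q
D≡64q² = solve 1 (λ q → con 64 :* (q :* q) := (con 4 :* (q :+ q)) :* (con 4 :* (q :+ q))) refl
  where
  open ℕ-Solver.+-*-Solver

D≤room : ∀ q .{{_ : ℕ.NonZero (q ℕ.* q)}} → Family.D q ℕ.≤ room q
D≤room q = ℕₚ.≤-trans (ℕₚ.≤-reflexive (sym (D≡64q² q))) (ℕₚ.*-monoʳ-≤ 64 (ℕₚ.m≤m*n (q ℕ.* q) (q ℕ.* q)))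

N≤room : ∀ q → Family.N q ℕ.≤ room q
N≤room q = ℕₚ.m≤n*m (Family.N q) 64

matrix : ∀ n → Matrix n n
matrix n = Family.A (param n) n

D≤n : ∀ q n → room q ℕ.≤ n → Family.N q ≢ 0 → Family.D q ℕ.≤ n
D≤n zero    n fits N≢0 = contradiction refl N≢0
D≤n (suc p) n fits _   = ℕₚ.≤-trans (D≤room (suc p)) fits

2≤room : ∀ p → 2 ℕ.≤ room (suc p)
2≤room p = ℕₚ.≤-trans (s≤s (s≤s z≤n)) (ℕₚ.m≤m*n 64 (Family.N (suc p)))

matrix-circuit : ∀ n → ∃[ C ] CancellationFree C × Computes C (matrix n)
matrix-circuit n = cancellationFreeCircuit (matrix n) (Family.A-nonzero (param n) (D≤n (param n) n (param-fits n)))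

matrix-size>0 : ∀ n → 2 ℕ.≤ n → ∀ D → Computes D (matrix n) → 0 ℕ.< size D
matrix-size>0 n@(suc _) 2≤n D D-A =
  HasTwo⇒size>0 D (matrix n) D-A zero (Family.A-two (param n) (D≤n (param n) n (param-fits n)) 2≤n zero)

small-param : ∀ n → n ℕ.< 2 → param n ≡ 0
small-param zero          _ = refl
small-param (suc zero)    _ = refl
small-param (suc (suc n)) (s≤s (s≤s ()))

-- Ratio bounds for all n

module Bounds (c : ℕ) (2≤c : 2 ℕ.≤ c) (slack : ∀ p → Slack c (suc p)) where

  loss : ℕ → ℚ
  loss n = (+ c) ℚ./ suc (param n)

  loss-isLittleO1 : IsLittleO1 loss
  loss-isLittleO1 δ 0<δ =
    let (L , large) = param-unbounded (c ℕ.* suc (ℚ.denominator-1 δ)) in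
    L , λ n L≤n → c/Q<δ c (param n) δ 0<δ (large n L≤n)

  -- Covers the parameter 0, where the claimed factor 2 - c is at most 0.
  sizes-compare₀ : ∀ c C D → 2 ℕ.≤ c → 2 ℕ.* 1 ℕ.* D ℕ.≤ 1 ℕ.* C + c ℕ.* D
  sizes-compare₀ c C D 2≤c = ℕₚ.≤-trans (ℕₚ.*-monoˡ-≤ D 2≤c) (ℕₚ.m≤n+m (c ℕ.* D) (1 ℕ.* C))

  family-sizes : ∀ q n → Family.D q ℕ.≤ n → Family.N q ℕ.≤ n → 2 ℕ.≤ n →
    Slack c q → ∀ C D → CancellationFree C → Computes C (Family.A q n) → IsSmallest (Family.A q n) D →
    2 ℕ.* suc q ℕ.* size D ℕ.≤ suc q ℕ.* size C + c ℕ.* size D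
  family-sizes q n D≤n N≤n 2≤n slack-q C D cf C-A (D-A , least) =
    sizes-compare (N q) (overhead q) (Family.D q) (size C) (size D) (suc q) c
      (lowerBound q D≤n N≤n C cf C-A) upper slack-q
    where
    open Family hiding (D)
    upper : size D ℕ.≤ N q + overhead q
    upper = let (E , E-A , E≤) = upperBound q D≤n 2≤n in
      ℕₚ.≤-trans (least E E-A) (ℕₚ.≤-trans E≤ (ℕₚ.≤-reflexive (cong (_+ overhead q) (ℕₚ.*-identityʳ (N q)))))

  fitting-sizes : ∀ q n → room q ℕ.≤ n → ∀ C D → CancellationFree C → Computes C (Family.A q n) →
    IsSmallest (Family.A q n) D → 2 ℕ.* suc q ℕ.* size D ℕ.≤ suc q ℕ.* size C + c ℕ.* size D
  fitting-sizes zero n fits C D cf C-A _ = sizes-compare₀ c (size C) (size D) 2≤c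
  fitting-sizes (suc p) n fits =
    family-sizes (suc p) n (ℕₚ.≤-trans (D≤room (suc p)) fits) (ℕₚ.≤-trans (N≤room (suc p)) fits)
                 (ℕₚ.≤-trans (2≤room p) fits) (slack p)

  matrix-sizes : ∀ n C D → CancellationFree C → Computes C (matrix n) → IsSmallest (matrix n) D →
    2 ℕ.* suc (param n) ℕ.* size D ℕ.≤ suc (param n) ℕ.* size C + c ℕ.* size D
  matrix-sizes n = fitting-sizes (param n) n (param-fits n)

  -- Smallest circuits are only obtained up to double negation, which the decidability of _≤_ removes.
  ratio-bound : ∀ n ρ → IsCancellationRatio n ρ → fromℕ 2 - loss n ≤ ρ
  ratio-bound n ρ ((A , C , D , _ , _ , nz , ρ≡) , greatest) = decidable-stable (_ ℚₚ.≤? ρ) (by-size (2 ℕₚ.≤? n))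
    where
    by-size : Dec (2 ℕ.≤ n) → ¬ ¬ (fromℕ 2 - loss n ≤ ρ)
    -- Here the parameter is 0 and the bound is trivial, so the circuits witnessing `ρ` itself can
    -- be used.
    by-size (no 2≰n) ¬bound = ¬bound (subst (fromℕ 2 - loss n ≤_) (sym ρ≡) (2-c/Q≤C/D c (param n) (size C) (size D) bound nz))
      where
      bound : 2 ℕ.* suc (param n) ℕ.* size D ℕ.≤ suc (param n) ℕ.* size C + c ℕ.* size D
      bound rewrite small-param n (ℕₚ.≰⇒> 2≰n) =
        sizes-compare₀ c (size C) (size D) 2≤c
    by-size (yes 2≤n) ¬bound =
      ¬¬smallest {P = λ C → CancellationFree C × Computes C (matrix n)} (matrix-circuit n) λ ((C₀ , (cf , C₀-A) , C₀-least)) →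
      ¬¬smallest {P = λ D → Computes D (matrix n)}
        (proj₁ (matrix-circuit n) , proj₂ (proj₂ (matrix-circuit n))) λ ((D₀ , D₀-A , D₀-least)) →
      let nz₀ = ℕ.>-nonZero (matrix-size>0 n 2≤n D₀ D₀-A) in
      -- The smallest circuits for `matrix n` give one of the ratios of which `ρ` is the maximum.
      ¬bound (ℚₚ.≤-trans
        (2-c/Q≤C/D c (param n) (size C₀) (size D₀) (matrix-sizes n C₀ D₀ cf C₀-A (D₀-A , D₀-least)) nz₀)
        (greatest (matrix n) _
          (C₀ , D₀ , (cf , C₀-A , λ C′ cf′ C′-A → C₀-least C′ (cf′ , C′-A)) , (D₀-A , D₀-least) , nz₀ , refl)))

  matrix-ratio : ∀ n C D → CancellationFree C → Computes C (matrix n) → IsSmallest (matrix n) D →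
    (fromℕ 2 - loss n) * fromℕ (size D) ≤ fromℕ (size C)
  matrix-ratio n C D cf C-A smallest =
    [2-c/Q]D≤C c (param n) (size C) (size D) (matrix-sizes n C D cf C-A smallest)

theorem2 : (Σ[ A ∈ (∀ n → Matrix n n) ] Σ[ ε ∈ (ℕ → ℚ) ]
    IsLittleO1 ε ×
    (∀ n →
    (∃[ C ] CancellationFree C × Computes C (A n)) ×
    (2 ℕ.≤ n → ∀ D → Computes D (A n) → 0 ℕ.< size D) ×
    (∀ C D → CancellationFree C → Computes C (A n) → IsSmallest (A n) D →
    (fromℕ 2 - ε n) * fromℕ (size D) ≤ fromℕ (size C))))
    ×
    (Σ[ ε ∈ (ℕ → ℚ) ]
    IsLittleO1 ε ×
    (∀ n ρ → IsCancellationRatio n ρ → fromℕ 2 - ε n ≤ ρ))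
theorem2 =
  (matrix , loss , loss-isLittleO1 , λ n →
    matrix-circuit n , matrix-size>0 n , λ C D cf C-A smallest →
      matrix-ratio n C D cf C-A smallest) ,
  (loss , loss-isLittleO1 , ratio-bound)
  where open Bounds 4248 (s≤s (s≤s z≤n)) slack-bound
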